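{- Let $k \ge 1$ be an integer, let $n = 2k$, and let $A = [a_{i,j}]$ be the $n \times n$ matrix with $a_{i,i+1} = a_{i+1,i} = 1$ for $i = 1,3,5,\ldots,n-1$, $a_{i,i} = 1$ for $i = 2,4,6,\ldots,n$, and all other entries $0$. Let $\alpha = \frac{1+\sqrt5}{2}$ and $\beta = \frac{1-\sqrt5}{2}$. For every positive integer $r$, write $A^r = [a_{i,j}(r)]_{n\times n}$. Then for each $i \in \{2,4,6,\ldots,n\}$, $$a_{i-1,i-1}(r) = \frac{1}{\alpha-\beta}\left(-\beta\alpha^{r} + \alpha\beta^{r}\right), \qquad a_{i,i}(r) = \frac{1}{\alpha-\beta}\left(\alpha^{r+1} - \beta^{r+1}\right),$$ $$a_{i-1,i}(r) = \frac{1}{\alpha-\beta}\left(\alpha^{r} - \beta^{r}\right), \qquad a_{i,i-1}(r) = \frac{1}{\alpha-\beta}\left(-\beta\alpha^{r+1} + \alpha\beta^{r+1}\right),$$ and all other entries of $A^r$ are $0$.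
   Context: The matrix $A$ is the block-diagonal matrix with $k$ diagonal blocks equal to $\begin{pmatrix}0&1\\1&1\end{pmatrix}$; it is the adjacency matrix of the graph on $2k$ vertices consisting of $k$ connected components, each being a single edge with a loop at one of its endpoints. The notation $a_{i,j}(r)$ denotes the $(i,j)$ entry of $A^r$. -}

module Defs where

open import Algebra.Bundles using (CommutativeRing; Semiring)
open import Data.Bool.Base using (if_then_else_)
open import Data.Fin.Base as Fin using (Fin; toℕ)
import Data.Fin.Properties as Fin
open import Data.Integer.Base as ℤ using (+_; +≤+; +<+)
import Data.Integer.Properties as ℤ
open import Data.Nat.Base as ℕ using (ℕ; zero; suc; z≤n; s≤s)
open import Data.Nat.Divisibility using (_∣_; _∣?_)
import Data.Nat.Properties as ℕ
open import Data.Product.Base using (_×_; _,_; ∃-syntax; proj₁; proj₂)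
open import Data.Rational.Base as ℚ using (ℚ; 0ℚ; 1ℚ; ½; ∣_∣; toℚᵘ; *≤*; *<*)
import Data.Rational.Properties as ℚ
import Data.Rational.Unnormalised.Base as ℚᵘ
import Data.Rational.Unnormalised.Properties as ℚᵘ
open import Data.Rational.Solver using (module +-*-Solver)
open import Data.Sum.Base using (_⊎_; inj₁; inj₂)
open import Level using (0ℓ)
open import Relation.Binary.PropositionalEquality.Core
  using (_≡_; _≢_; refl; sym; trans; cong; cong₂; subst; subst₂)
open import Relation.Binary.Structures using (IsEquivalence)
open import Relation.Nullary.Decidable
  using (Dec; yes; no; ⌊_⌋; _×-dec_; _⊎-dec_; ¬?)
open import Relation.Nullary.Negation using (¬_; contradiction)

private
  variable
    p q r s ε δ : ℚ

private
  module Est where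
    open +-*-Solver

    nn : 0ℚ ℚ.≤ p → ℚ.NonNegative p
    nn = ℚ.nonNegative

    0<*0< : 0ℚ ℚ.< p → 0ℚ ℚ.< q → 0ℚ ℚ.< p ℚ.* q
    0<*0< {p} {q} a b =
      ℚ.positive⁻¹ (p ℚ.* q) {{ℚ.pos*pos⇒pos p {{ℚ.positive a}} q {{ℚ.positive b}}}}

    0<½ : 0ℚ ℚ.< ½
    0<½ = ℚ.positive⁻¹ ½

    *-mono-≤₀ : 0ℚ ℚ.≤ p → 0ℚ ℚ.≤ s → p ℚ.≤ q → r ℚ.≤ s → p ℚ.* r ℚ.≤ q ℚ.* s
    *-mono-≤₀ {p} {s} 0≤p 0≤s p≤q r≤s = ℚ.≤-trans
      (ℚ.*-monoˡ-≤-nonNeg p {{nn 0≤p}} r≤s)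
      (ℚ.*-monoʳ-≤-nonNeg s {{nn 0≤s}} p≤q)

    half+half : ∀ p → p ℚ.* ½ ℚ.+ p ℚ.* ½ ≡ p
    half+half p = trans (sym (ℚ.*-distribˡ-+ p ½ ½)) (ℚ.*-identityʳ p)

    recip : 0ℚ ℚ.< p → ∃[ q ] 0ℚ ℚ.< q × p ℚ.* q ≡ 1ℚ
    recip {p} 0<p = (ℚ.1/ p) {{nz}}
      , ℚ.positive⁻¹ _ {{ℚ.1/pos⇒pos p {{ℚ.positive 0<p}}}}
      , ℚ.*-inverseʳ p {{nz}}
      where nz = ℚ.>-nonZero 0<p

    shrink : 0ℚ ℚ.< p → 0ℚ ℚ.< ε → ∃[ δ ] 0ℚ ℚ.< δ × p ℚ.* δ ≡ ε
    shrink {p} {ε} 0<p 0<ε with q , 0<q , pq≡1 ← recip 0<p =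
      ε ℚ.* q , 0<*0< 0<ε 0<q ,
      trans (solve 3 (λ p e q → p :* (e :* q) := e :* (p :* q)) refl p ε q)
        (trans (cong (ε ℚ.*_) pq≡1) (ℚ.*-identityʳ ε))

    abs-sym : ∀ p q → ∣ p ℚ.- q ∣ ≡ ∣ q ℚ.- p ∣
    abs-sym p q = trans
      (cong ∣_∣ (solve 2 (λ p q → p :- q := :- (q :- p)) refl p q))
      (ℚ.∣-p∣≡∣p∣ (q ℚ.- p))

    abs-self : p ≡ q → 0ℚ ℚ.≤ ε → ∣ p ℚ.- q ∣ ℚ.≤ ε
    abs-self {p} refl 0≤ε = subst (ℚ._≤ _) (sym (cong ∣_∣ (ℚ.+-inverseʳ p))) 0≤ε

    abs-+ : ∀ p q r s → ∣ p ℚ.- r ∣ ℚ.≤ ε ℚ.* ½ → ∣ q ℚ.- s ∣ ℚ.≤ ε ℚ.* ½ →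
            ∣ (p ℚ.+ q) ℚ.- (r ℚ.+ s) ∣ ℚ.≤ ε
    abs-+ {ε} p q r s a b = subst₂ ℚ._≤_
      (cong ∣_∣ (solve 4 (λ p q r s → (p :- r) :+ (q :- s) := (p :+ q) :- (r :+ s)) refl p q r s))
      (half+half ε)
      (ℚ.≤-trans (ℚ.∣p+q∣≤∣p∣+∣q∣ (p ℚ.- r) (q ℚ.- s)) (ℚ.+-mono-≤ a b))

    abs-trans : ∀ p q r → ∣ p ℚ.- q ∣ ℚ.≤ ε ℚ.* ½ → ∣ q ℚ.- r ∣ ℚ.≤ ε ℚ.* ½ →
                ∣ p ℚ.- r ∣ ℚ.≤ ε
    abs-trans {ε} p q r a b = subst (ℚ._≤ ε)
      (cong ∣_∣ (solve 3 (λ p q r → (p :+ q) :- (q :+ r) := p :- r) refl p q r))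
      (abs-+ p q q r a b)

    abs-neg : ∀ p q → ∣ p ℚ.- q ∣ ℚ.≤ ε → ∣ (ℚ.- p) ℚ.- (ℚ.- q) ∣ ℚ.≤ ε
    abs-neg {ε} p q = subst (ℚ._≤ ε) (trans (abs-sym p q)
      (cong ∣_∣ (solve 2 (λ p q → q :- p := (:- p) :- (:- q)) refl p q)))

    abs-* : ∀ {B} p q r s → ∣ p ∣ ℚ.≤ B → ∣ s ∣ ℚ.≤ B → B ℚ.* δ ≡ ε ℚ.* ½ → 0ℚ ℚ.≤ δ →
            ∣ p ℚ.- r ∣ ℚ.≤ δ → ∣ q ℚ.- s ∣ ℚ.≤ δ → ∣ p ℚ.* q ℚ.- r ℚ.* s ∣ ℚ.≤ ε
    abs-* {δ} {ε} {B} p q r s p≤B s≤B Bδ 0≤δ a b = subst₂ ℚ._≤_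
      (cong ∣_∣ (solve 4 (λ p q r s → p :* (q :- s) :+ s :* (p :- r) := p :* q :- r :* s) refl p q r s))
      (trans (cong₂ ℚ._+_ Bδ Bδ) (half+half ε))
      (ℚ.≤-trans (ℚ.∣p+q∣≤∣p∣+∣q∣ (p ℚ.* (q ℚ.- s)) (s ℚ.* (p ℚ.- r)))
        (ℚ.+-mono-≤ (bnd p (q ℚ.- s) p≤B b) (bnd s (p ℚ.- r) s≤B a)))
      where
      bnd : ∀ u v → ∣ u ∣ ℚ.≤ B → ∣ v ∣ ℚ.≤ δ → ∣ u ℚ.* v ∣ ℚ.≤ B ℚ.* δ
      bnd u v u≤ v≤ = subst (ℚ._≤ _) (sym (ℚ.∣p*q∣≡∣p∣*∣q∣ u v))
        (*-mono-≤₀ (ℚ.0≤∣p∣ u) 0≤δ u≤ v≤)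

    abs-bound : ∀ p q → ∣ p ℚ.- q ∣ ℚ.≤ 1ℚ → ∣ p ∣ ℚ.≤ 1ℚ ℚ.+ ∣ q ∣
    abs-bound p q a = subst (λ t → ∣ t ∣ ℚ.≤ 1ℚ ℚ.+ ∣ q ∣)
      (solve 2 (λ p q → (p :- q) :+ q := p) refl p q)
      (ℚ.≤-trans (ℚ.∣p+q∣≤∣p∣+∣q∣ (p ℚ.- q) q) (ℚ.+-monoˡ-≤ ∣ q ∣ a))

    abs-intro : p ℚ.≤ q ℚ.+ ε → q ℚ.≤ p ℚ.+ ε → ∣ p ℚ.- q ∣ ℚ.≤ ε
    abs-intro {p} {q} {ε} a b with ℚ.∣p∣≡p∨∣p∣≡-p (p ℚ.- q)
    ... | inj₁ e = subst₂ ℚ._≤_ (sym e)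
      (solve 2 (λ q e → (q :+ e) :+ (:- q) := e) refl q ε) (ℚ.+-monoˡ-≤ (ℚ.- q) a)
    ... | inj₂ e = subst₂ ℚ._≤_
      (trans (solve 2 (λ p q → q :+ (:- p) := :- (p :- q)) refl p q) (sym e))
      (solve 2 (λ q e → (q :+ e) :+ (:- q) := e) refl p ε) (ℚ.+-monoˡ-≤ (ℚ.- p) b)

open Est

-- Real numbers are Cauchy sequences of rationals, with _≈_ as equality.
infix 4 _≈_ _#_

record ℝ : Set where
  no-eta-equality
  field
    seq    : ℕ → ℚ
    cauchy : ∀ ε → 0ℚ ℚ.< ε →
             ∃[ N ] ∀ m n → N ℕ.≤ m → N ℕ.≤ n → ∣ seq m ℚ.- seq n ∣ ℚ.≤ ε

open ℝ public

record _≈_ (x y : ℝ) : Set where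
  constructor mk≈
  field
    close : ∀ ε → 0ℚ ℚ.< ε →
            ∃[ N ] ∀ n → N ℕ.≤ n → ∣ seq x n ℚ.- seq y n ∣ ℚ.≤ ε

open _≈_ public

-- Apartness (positive distance) is the constructive form of ≠ that a
-- denominator has to satisfy.
record _#_ (x y : ℝ) : Set where
  constructor mk#
  field
    gap      : ℚ
    0<gap    : 0ℚ ℚ.< gap
    from     : ℕ
    distance : ∀ n → from ℕ.≤ n → gap ℚ.≤ ∣ seq x n ℚ.- seq y n ∣

fromℚ : ℚ → ℝ
seq    (fromℚ p) _     = p
cauchy (fromℚ p) ε 0<ε = 0 , λ _ _ _ _ → abs-self {p} refl (ℚ.<⇒≤ 0<ε)

0ℝ 1ℝ 2ℝ : ℝ
0ℝ = fromℚ 0ℚ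
1ℝ = fromℚ 1ℚ
2ℝ = fromℚ (+ 2 ℚ./ 1)

infixl 6 _+_ _-_
infixl 7 _*_ _÷_
infix  8 -_

_+_ : ℝ → ℝ → ℝ
seq    (x + y) n     = seq x n ℚ.+ seq y n
cauchy (x + y) ε 0<ε =
  let 0<ε/2 = 0<*0< 0<ε 0<½
      M , f = cauchy x _ 0<ε/2
      N , g = cauchy y _ 0<ε/2
  in M ℕ.⊔ N , λ m n m≥ n≥ → abs-+ (seq x m) (seq y m) (seq x n) (seq y n)
       (f m n (ℕ.m⊔n≤o⇒m≤o M N m≥) (ℕ.m⊔n≤o⇒m≤o M N n≥))
       (g m n (ℕ.m⊔n≤o⇒n≤o M N m≥) (ℕ.m⊔n≤o⇒n≤o M N n≥))

-_ : ℝ → ℝ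
seq    (- x) n     = ℚ.- seq x n
cauchy (- x) ε 0<ε =
  let N , f = cauchy x ε 0<ε
  in N , λ m n m≥ n≥ → abs-neg (seq x m) (seq x n) (f m n m≥ n≥)

_-_ : ℝ → ℝ → ℝ
x - y = x + (- y)

bounded : ∀ x → ∃[ B ] 0ℚ ℚ.< B × ∃[ N ] ∀ n → N ℕ.≤ n → ∣ seq x n ∣ ℚ.≤ B
bounded x with N , f ← cauchy x 1ℚ (ℚ.positive⁻¹ 1ℚ) =
  1ℚ ℚ.+ ∣ seq x N ∣
  , ℚ.+-mono-<-≤ (ℚ.positive⁻¹ 1ℚ) (ℚ.0≤∣p∣ (seq x N))
  , N , λ n n≥ → abs-bound (seq x n) (seq x N) (f n N n≥ ℕ.≤-refl)

private
  bounded₂ : ∀ x y → ∃[ B ] 0ℚ ℚ.< B ×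
             ∃[ N ] ∀ m n → N ℕ.≤ m → N ℕ.≤ n → ∣ seq x m ∣ ℚ.≤ B × ∣ seq y n ∣ ℚ.≤ B
  bounded₂ x y =
    let B , 0<B , M , f = bounded x
        C , 0<C , N , g = bounded y
    in B ℚ.+ C , ℚ.+-mono-< 0<B 0<C , M ℕ.⊔ N , λ m n m≥ n≥ →
       ℚ.≤-trans (f m (ℕ.m⊔n≤o⇒m≤o M N m≥))
         (subst (ℚ._≤ B ℚ.+ C) (ℚ.+-identityʳ B) (ℚ.+-monoʳ-≤ B (ℚ.<⇒≤ 0<C)))
     , ℚ.≤-trans (g n (ℕ.m⊔n≤o⇒n≤o M N n≥))
         (subst (ℚ._≤ B ℚ.+ C) (ℚ.+-identityˡ C) (ℚ.+-monoˡ-≤ C (ℚ.<⇒≤ 0<B)))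

_*_ : ℝ → ℝ → ℝ
seq    (x * y) n     = seq x n ℚ.* seq y n
cauchy (x * y) ε 0<ε =
  let B , 0<B , K , b = bounded₂ x y
      δ , 0<δ , Bδ    = shrink 0<B (0<*0< 0<ε 0<½)
      M , f = cauchy x δ 0<δ
      N , g = cauchy y δ 0<δ
      L = K ℕ.⊔ (M ℕ.⊔ N)
      K≤ : ∀ {n} → L ℕ.≤ n → K ℕ.≤ n
      K≤ = ℕ.m⊔n≤o⇒m≤o K (M ℕ.⊔ N)
      M≤ : ∀ {n} → L ℕ.≤ n → M ℕ.≤ n
      M≤ l = ℕ.m⊔n≤o⇒m≤o M N (ℕ.m⊔n≤o⇒n≤o K (M ℕ.⊔ N) l)
      N≤ : ∀ {n} → L ℕ.≤ n → N ℕ.≤ n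
      N≤ l = ℕ.m⊔n≤o⇒n≤o M N (ℕ.m⊔n≤o⇒n≤o K (M ℕ.⊔ N) l)
  in L , λ m n m≥ n≥ → abs-* (seq x m) (seq y m) (seq x n) (seq y n)
       (proj₁ (b m n (K≤ m≥) (K≤ n≥))) (proj₂ (b m n (K≤ m≥) (K≤ n≥)))
       Bδ (ℚ.<⇒≤ 0<δ)
       (f m n (M≤ m≥) (M≤ n≥)) (g m n (N≤ m≥) (N≤ n≥))

-- Finitely many terms of a sequence apart from 0 may vanish; the value
-- given to them here is irrelevant.
invℚ : ℚ → ℚ
invℚ p with p ℚ.≟ 0ℚ
... | yes _   = 0ℚ
... | no p≢0 = (ℚ.1/ p) {{ℚ.≢-nonZero p≢0}}

private
  invℚ-inverse : p ≢ 0ℚ → p ℚ.* invℚ p ≡ 1ℚ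
  invℚ-inverse {p} p≢0 with p ℚ.≟ 0ℚ
  ... | yes e    = contradiction e p≢0
  ... | no p≢0′ = ℚ.*-inverseʳ p {{ℚ.≢-nonZero p≢0′}}

  away : 0ℚ ℚ.< δ → δ ℚ.≤ ∣ p ℚ.- 0ℚ ∣ → δ ℚ.≤ ∣ p ∣ × p ≢ 0ℚ
  away {δ} {p} 0<δ le = le′ , λ e → ℚ.<⇒≢ (ℚ.<-≤-trans 0<δ le′) (sym (cong ∣_∣ e))
    where
    le′ = subst (λ t → δ ℚ.≤ ∣ t ∣) (ℚ.+-identityʳ p) le

  abs-invℚ : ∀ p q → 0ℚ ℚ.< δ → δ ℚ.≤ ∣ p ∣ × p ≢ 0ℚ → δ ℚ.≤ ∣ q ∣ × q ≢ 0ℚ →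
             ∣ p ℚ.- q ∣ ℚ.≤ ε ℚ.* (δ ℚ.* δ) → 0ℚ ℚ.< ε →
             ∣ invℚ p ℚ.- invℚ q ∣ ℚ.≤ ε
  abs-invℚ {δ} {ε} p q 0<δ (δ≤p , p≢0) (δ≤q , q≢0) a 0<ε = begin
    ∣ u ℚ.- v ∣                                 ≡⟨ cong ∣_∣ diff ⟩
    ∣ (q ℚ.- p) ℚ.* (u ℚ.* v) ∣                 ≡⟨ ℚ.∣p*q∣≡∣p∣*∣q∣ (q ℚ.- p) (u ℚ.* v) ⟩
    ∣ q ℚ.- p ∣ ℚ.* ∣ u ℚ.* v ∣                 ≡⟨ cong₂ ℚ._*_ (abs-sym q p) (ℚ.∣p*q∣≡∣p∣*∣q∣ u v) ⟩
    ∣ p ℚ.- q ∣ ℚ.* (∣ u ∣ ℚ.* ∣ v ∣)           ≤⟨ ℚ.*-monoʳ-≤-nonNeg _ {{nn 0≤uv}} a ⟩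
    ε ℚ.* (δ ℚ.* δ) ℚ.* (∣ u ∣ ℚ.* ∣ v ∣)       ≡⟨ solve 4 (λ e d a b → e :* (d :* d) :* (a :* b) := e :* ((d :* a) :* (d :* b))) refl ε δ ∣ u ∣ ∣ v ∣ ⟩
    ε ℚ.* ((δ ℚ.* ∣ u ∣) ℚ.* (δ ℚ.* ∣ v ∣))     ≤⟨ ℚ.*-monoˡ-≤-nonNeg ε {{nn (ℚ.<⇒≤ 0<ε)}}
                                                     (*-mono-≤₀ 0≤δu 0≤1 (small p δ≤p p≢0) (small q δ≤q q≢0)) ⟩
    ε ℚ.* (1ℚ ℚ.* 1ℚ)                           ≡⟨ ℚ.*-identityʳ ε ⟩
    ε                                           ∎
    where
    open ℚ.≤-Reasoning
    open +-*-Solver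
    u = invℚ p
    v = invℚ q
    0≤1 = ℚ.<⇒≤ (ℚ.positive⁻¹ 1ℚ)
    0≤uv : 0ℚ ℚ.≤ ∣ u ∣ ℚ.* ∣ v ∣
    0≤uv = subst (0ℚ ℚ.≤_) (ℚ.∣p*q∣≡∣p∣*∣q∣ u v) (ℚ.0≤∣p∣ (u ℚ.* v))
    0≤δu : 0ℚ ℚ.≤ δ ℚ.* ∣ u ∣
    0≤δu = subst (ℚ._≤ δ ℚ.* ∣ u ∣) (ℚ.*-zeroʳ δ)
      (ℚ.*-monoˡ-≤-nonNeg δ {{nn (ℚ.<⇒≤ 0<δ)}} (ℚ.0≤∣p∣ u))
    small : ∀ t → δ ℚ.≤ ∣ t ∣ → t ≢ 0ℚ → δ ℚ.* ∣ invℚ t ∣ ℚ.≤ 1ℚ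
    small t δ≤t t≢0 = subst (δ ℚ.* ∣ invℚ t ∣ ℚ.≤_)
      (trans (sym (ℚ.∣p*q∣≡∣p∣*∣q∣ t (invℚ t))) (cong ∣_∣ (invℚ-inverse t≢0)))
      (ℚ.*-monoʳ-≤-nonNeg ∣ invℚ t ∣ {{ℚ.∣-∣-nonNeg (invℚ t)}} δ≤t)
    diff : u ℚ.- v ≡ (q ℚ.- p) ℚ.* (u ℚ.* v)
    diff = begin-equality
      u ℚ.- v                              ≡⟨ cong₂ ℚ._-_ (sym (ℚ.*-identityʳ u)) (sym (ℚ.*-identityʳ v)) ⟩
      u ℚ.* 1ℚ ℚ.- v ℚ.* 1ℚ                ≡⟨ cong₂ (λ a b → u ℚ.* a ℚ.- v ℚ.* b) (sym (invℚ-inverse q≢0)) (sym (invℚ-inverse p≢0)) ⟩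
      u ℚ.* (q ℚ.* v) ℚ.- v ℚ.* (p ℚ.* u)  ≡⟨ solve 4 (λ p q u v → u :* (q :* v) :- v :* (p :* u) := (q :- p) :* (u :* v)) refl p q u v ⟩
      (q ℚ.- p) ℚ.* (u ℚ.* v)              ∎

inv : (x : ℝ) → x # 0ℝ → ℝ
seq    (inv x _) n = invℚ (seq x n)
cauchy (inv x (mk# δ 0<δ K d)) ε 0<ε =
  let N , f = cauchy x (ε ℚ.* (δ ℚ.* δ)) (0<*0< 0<ε (0<*0< 0<δ 0<δ))
  in K ℕ.⊔ N , λ m n m≥ n≥ → abs-invℚ (seq x m) (seq x n) 0<δ
       (away 0<δ (d m (ℕ.m⊔n≤o⇒m≤o K N m≥)))
       (away 0<δ (d n (ℕ.m⊔n≤o⇒m≤o K N n≥)))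
       (f m n (ℕ.m⊔n≤o⇒n≤o K N m≥) (ℕ.m⊔n≤o⇒n≤o K N n≥)) 0<ε

_÷_ : (x y : ℝ) → {{y # 0ℝ}} → ℝ
_÷_ x y {{y#0}} = x * inv y y#0

≗⇒≈ : ∀ {x y} → (∀ n → seq x n ≡ seq y n) → x ≈ y
≗⇒≈ e = mk≈ λ ε 0<ε → 0 , λ n _ → abs-self (e n) (ℚ.<⇒≤ 0<ε)

≈-refl : ∀ {x} → x ≈ x
≈-refl = ≗⇒≈ λ _ → refl

≈-sym : ∀ {x y} → x ≈ y → y ≈ x
≈-sym {x} {y} e = mk≈ λ ε 0<ε →
  let N , f = close e ε 0<ε
  in N , λ n n≥ → subst (ℚ._≤ ε) (abs-sym (seq x n) (seq y n)) (f n n≥)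

≈-trans : ∀ {x y z} → x ≈ y → y ≈ z → x ≈ z
≈-trans {x} {y} {z} d e = mk≈ λ ε 0<ε →
  let 0<ε/2 = 0<*0< 0<ε 0<½
      M , f = close d _ 0<ε/2
      N , g = close e _ 0<ε/2
  in M ℕ.⊔ N , λ n n≥ → abs-trans (seq x n) (seq y n) (seq z n)
       (f n (ℕ.m⊔n≤o⇒m≤o M N n≥)) (g n (ℕ.m⊔n≤o⇒n≤o M N n≥))

≈-isEquivalence : IsEquivalence _≈_
≈-isEquivalence = record { refl = ≈-refl ; sym = ≈-sym ; trans = ≈-trans }

+-cong : ∀ {x y u v} → x ≈ y → u ≈ v → (x + u) ≈ (y + v)
+-cong {x} {y} {u} {v} d e = mk≈ λ ε 0<ε →
  let 0<ε/2 = 0<*0< 0<ε 0<½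
      M , f = close d _ 0<ε/2
      N , g = close e _ 0<ε/2
  in M ℕ.⊔ N , λ n n≥ → abs-+ (seq x n) (seq u n) (seq y n) (seq v n)
       (f n (ℕ.m⊔n≤o⇒m≤o M N n≥)) (g n (ℕ.m⊔n≤o⇒n≤o M N n≥))

-‿cong : ∀ {x y} → x ≈ y → (- x) ≈ (- y)
-‿cong {x} {y} e = mk≈ λ ε 0<ε →
  let N , f = close e ε 0<ε
  in N , λ n n≥ → abs-neg (seq x n) (seq y n) (f n n≥)

*-cong : ∀ {x y u v} → x ≈ y → u ≈ v → (x * u) ≈ (y * v)
*-cong {x} {y} {u} {v} d e = mk≈ λ ε 0<ε →
  let B , 0<B , K , b = bounded₂ x v
      δ , 0<δ , Bδ    = shrink 0<B (0<*0< 0<ε 0<½)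
      M , f = close d δ 0<δ
      N , g = close e δ 0<δ
      L = K ℕ.⊔ (M ℕ.⊔ N)
  in L , λ n n≥ →
       let K≤ = ℕ.m⊔n≤o⇒m≤o K (M ℕ.⊔ N) n≥
           R≤ = ℕ.m⊔n≤o⇒n≤o K (M ℕ.⊔ N) n≥
       in abs-* (seq x n) (seq u n) (seq y n) (seq v n)
            (proj₁ (b n n K≤ K≤)) (proj₂ (b n n K≤ K≤)) Bδ (ℚ.<⇒≤ 0<δ)
            (f n (ℕ.m⊔n≤o⇒m≤o M N R≤)) (g n (ℕ.m⊔n≤o⇒n≤o M N R≤))

ℝ-commutativeRing : CommutativeRing 0ℓ 0ℓ
ℝ-commutativeRing = record
  { Carrier = ℝ ; _≈_ = _≈_ ; _+_ = _+_ ; _*_ = _*_ ; -_ = -_ ; 0# = 0ℝ ; 1# = 1ℝ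
  ; isCommutativeRing = record
    { isRing = record
      { +-isAbelianGroup = record
        { isGroup = record
          { isMonoid = record
            { isSemigroup = record
              { isMagma = record { isEquivalence = ≈-isEquivalence ; ∙-cong = +-cong }
              ; assoc = λ x y z → ≗⇒≈ λ n → ℚ.+-assoc (seq x n) (seq y n) (seq z n)
              }
            ; identity = (λ x → ≗⇒≈ λ n → ℚ.+-identityˡ (seq x n))
                       , (λ x → ≗⇒≈ λ n → ℚ.+-identityʳ (seq x n))
            }
          ; inverse = (λ x → ≗⇒≈ λ n → ℚ.+-inverseˡ (seq x n))
                    , (λ x → ≗⇒≈ λ n → ℚ.+-inverseʳ (seq x n))
          ; ⁻¹-cong = -‿cong
          }
        ; comm = λ x y → ≗⇒≈ λ n → ℚ.+-comm (seq x n) (seq y n)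
        }
      ; *-cong = *-cong
      ; *-assoc = λ x y z → ≗⇒≈ λ n → ℚ.*-assoc (seq x n) (seq y n) (seq z n)
      ; *-identity = (λ x → ≗⇒≈ λ n → ℚ.*-identityˡ (seq x n))
                   , (λ x → ≗⇒≈ λ n → ℚ.*-identityʳ (seq x n))
      ; distrib = (λ x y z → ≗⇒≈ λ n → ℚ.*-distribˡ-+ (seq x n) (seq y n) (seq z n))
                , (λ x y z → ≗⇒≈ λ n → ℚ.*-distribʳ-+ (seq x n) (seq y n) (seq z n))
      }
    ; *-comm = λ x y → ≗⇒≈ λ n → ℚ.*-comm (seq x n) (seq y n)
    }
  }

*-inverseʳ : ∀ x (x#0 : x # 0ℝ) → (x * inv x x#0) ≈ 1ℝ
*-inverseʳ x (mk# δ 0<δ K d) = mk≈ λ ε 0<ε →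
  K , λ n n≥ → abs-self (invℚ-inverse (proj₂ (away {p = seq x n} 0<δ (d n n≥)))) (ℚ.<⇒≤ 0<ε)

open import Algebra.Definitions.RawSemiring
  (Semiring.rawSemiring (CommutativeRing.semiring ℝ-commutativeRing)) public
  using (_^_; sum)

-- ⌊ √n ⌋
isqrt : ℕ → ℕ
isqrt zero    = 0
isqrt (suc n) =
  if ⌊ suc (isqrt n) ℕ.* suc (isqrt n) ℕ.≤? suc n ⌋ then suc (isqrt n) else isqrt n

isqrt-lower : ∀ n → isqrt n ℕ.* isqrt n ℕ.≤ n
isqrt-lower zero = z≤n
isqrt-lower (suc n) with suc (isqrt n) ℕ.* suc (isqrt n) ℕ.≤? suc n
... | yes le = le
... | no _   = ℕ.m≤n⇒m≤1+n (isqrt-lower n)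

isqrt-upper : ∀ n → n ℕ.< suc (isqrt n) ℕ.* suc (isqrt n)
isqrt-upper zero = s≤s z≤n
isqrt-upper (suc n) with suc (isqrt n) ℕ.* suc (isqrt n) ℕ.≤? suc n
... | no ≰  = ℕ.≰⇒> ≰
... | yes _ = ℕ.≤-<-trans (isqrt-upper n)
  (ℕ.*-mono-< (ℕ.n<1+n (suc (isqrt n))) (ℕ.n<1+n (suc (isqrt n))))

-- The approximations ⌊ (n + 1) √c ⌋ / (n + 1) to √c.
√-seq : ℕ → ℕ → ℚ
√-seq c n = + isqrt (c ℕ.* (suc n ℕ.* suc n)) ℚ./ suc n

private
  ι : ℕ → ℚ
  ι n = + n ℚ./ 1

  h : ℕ → ℚ
  h n = + 1 ℚ./ suc n

  toᵘ : ∀ a n → toℚᵘ (+ a ℚ./ suc n) ℚᵘ.≃ (ℚᵘ.mkℚᵘ (+ a) n)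
  toᵘ a n = ℚ.toℚᵘ-fromℚᵘ (ℚᵘ.mkℚᵘ (+ a) n)

  /-mono-≤ : ∀ a m b n → a ℕ.* suc n ℕ.≤ b ℕ.* suc m → + a ℚ./ suc m ℚ.≤ + b ℚ./ suc n
  /-mono-≤ a m b n le = ℚ.toℚᵘ-cancel-≤
    (ℚᵘ.≤-respˡ-≃ (ℚᵘ.≃-sym (toᵘ a m)) (ℚᵘ.≤-respʳ-≃ (ℚᵘ.≃-sym (toᵘ b n))
      (ℚᵘ.*≤* (subst₂ ℤ._≤_ (ℤ.pos-* a (suc n)) (ℤ.pos-* b (suc m)) (+≤+ le)))))

  /-mono-< : ∀ a m b n → a ℕ.* suc n ℕ.< b ℕ.* suc m → + a ℚ./ suc m ℚ.< + b ℚ./ suc n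
  /-mono-< a m b n lt = ℚ.toℚᵘ-cancel-<
    (ℚᵘ.<-respˡ-≃ (ℚᵘ.≃-sym (toᵘ a m)) (ℚᵘ.<-respʳ-≃ (ℚᵘ.≃-sym (toᵘ b n))
      (ℚᵘ.*<* (subst₂ ℤ._<_ (ℤ.pos-* a (suc n)) (ℤ.pos-* b (suc m)) (+<+ lt)))))

  /-square : ∀ a n → (+ a ℚ./ suc n) ℚ.* (+ a ℚ./ suc n) ≡ + (a ℕ.* a) ℚ./ (suc n ℕ.* suc n)
  /-square a n = ℚ.toℚᵘ-injective (ℚᵘ.≃-trans (ℚ.toℚᵘ-homo-* (+ a ℚ./ suc n) (+ a ℚ./ suc n))
    (ℚᵘ.≃-trans (ℚᵘ.*-cong (toᵘ a n) (toᵘ a n))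
    (ℚᵘ.≃-trans (ℚᵘ.*≡* (cong (ℤ._* (+ (suc n ℕ.* suc n))) (sym (ℤ.pos-* a a))))
      (ℚᵘ.≃-sym (toᵘ (a ℕ.* a) (n ℕ.+ n ℕ.* suc n))))))

  /-suc : ∀ a n → + suc a ℚ./ suc n ≡ + a ℚ./ suc n ℚ.+ h n
  /-suc a n = ℚ.toℚᵘ-injective (ℚᵘ.≃-trans (toᵘ (suc a) n) (ℚᵘ.≃-sym
    (ℚᵘ.≃-trans (ℚ.toℚᵘ-homo-+ (+ a ℚ./ suc n) (h n))
    (ℚᵘ.≃-trans (ℚᵘ.+-cong (toᵘ a n) (toᵘ 1 n)) (ℚᵘ.*≡* eq)))))
    where
    d = + suc n
    eq : (+ a ℤ.* d ℤ.+ + 1 ℤ.* d) ℤ.* d ≡ + suc a ℤ.* (d ℤ.* d)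
    eq = trans (cong (ℤ._* d) (trans (sym (ℤ.*-distribʳ-+ d (+ a) (+ 1)))
                 (cong (λ t → + t ℤ.* d) (ℕ.+-comm a 1))))
               (ℤ.*-assoc (+ suc a) d d)

  0<h : ∀ n → 0ℚ ℚ.< h n
  0<h n = /-mono-< 0 0 1 n (s≤s z≤n)

  h-antitone : ∀ {m n} → m ℕ.≤ n → h n ℚ.≤ h m
  h-antitone {m} {n} le = /-mono-≤ 1 n 1 m (ℕ.*-monoʳ-≤ 1 (s≤s le))

  archimedean : ∀ ε → 0ℚ ℚ.< ε → ∃[ N ] ∀ n → N ℕ.≤ n → h n ℚ.≤ ε
  archimedean ε 0<ε with ε in e | ℚ.positive 0<ε
  ... | ℚ.mkℚ (ℤ.+[1+ a ]) d c | _ = d , λ n le → ℚ.≤-trans (h-antitone le)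
    (subst (h d ℚ.≤_) (ℚ.↥p/↧p≡p (ℚ.mkℚ (ℤ.+[1+ a ]) d c))
      (/-mono-≤ 1 d (suc a) d (ℕ.*-monoˡ-≤ (suc d) {1} {suc a} (s≤s z≤n))))

  0≤√ : ∀ c n → 0ℚ ℚ.≤ √-seq c n
  0≤√ c n = /-mono-≤ 0 0 (isqrt (c ℕ.* (suc n ℕ.* suc n))) n z≤n

  √-lower : ∀ c n → √-seq c n ℚ.* √-seq c n ℚ.≤ ι c
  √-lower c n = subst (ℚ._≤ ι c) (sym (/-square a n))
    (/-mono-≤ (a ℕ.* a) (n ℕ.+ n ℕ.* suc n) c 0
      (subst (ℕ._≤ c ℕ.* (suc n ℕ.* suc n)) (sym (ℕ.*-identityʳ (a ℕ.* a)))
        (isqrt-lower (c ℕ.* (suc n ℕ.* suc n)))))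
    where a = isqrt (c ℕ.* (suc n ℕ.* suc n))

  √-upper : ∀ c n → ι c ℚ.< (√-seq c n ℚ.+ h n) ℚ.* (√-seq c n ℚ.+ h n)
  √-upper c n = subst (ι c ℚ.<_)
    (trans (sym (/-square (suc a) n)) (cong₂ ℚ._*_ (/-suc a n) (/-suc a n)))
    (/-mono-< c 0 (suc a ℕ.* suc a) (n ℕ.+ n ℕ.* suc n)
      (subst (c ℕ.* (suc n ℕ.* suc n) ℕ.<_) (sym (ℕ.*-identityʳ (suc a ℕ.* suc a)))
        (isqrt-upper (c ℕ.* (suc n ℕ.* suc n)))))
    where a = isqrt (c ℕ.* (suc n ℕ.* suc n))

  √-near : ∀ c m n → √-seq c m ℚ.≤ √-seq c n ℚ.+ h n
  √-near c m n with √-seq c m ℚ.≤? √-seq c n ℚ.+ h n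
  ... | yes le = le
  ... | no ≰ = contradiction
    (ℚ.<-≤-trans (√-upper c n) (ℚ.≤-trans
      (*-mono-≤₀ 0≤t (0≤√ c m) (ℚ.<⇒≤ (ℚ.≰⇒> ≰)) (ℚ.<⇒≤ (ℚ.≰⇒> ≰))) (√-lower c m)))
    (ℚ.<-irrefl refl)
    where
    0≤t : 0ℚ ℚ.≤ √-seq c n ℚ.+ h n
    0≤t = ℚ.+-mono-≤ (0≤√ c n) (ℚ.<⇒≤ (0<h n))

√ : ℕ → ℝ
seq    (√ c)       = √-seq c
cauchy (√ c) ε 0<ε =
  let N , f = archimedean ε 0<ε
  in N , λ m n m≥ n≥ → abs-intro
       (ℚ.≤-trans (√-near c m n) (ℚ.+-monoʳ-≤ (√-seq c n) (f n n≥)))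
       (ℚ.≤-trans (√-near c n m) (ℚ.+-monoʳ-≤ (√-seq c m) (f m m≥)))

√-square : ∀ c → (√ c * √ c) ≈ fromℚ (+ c ℚ./ 1)
√-square c = mk≈ λ ε 0<ε →
  let B , 0<B , K , b = bounded (√ c)
      0<C             = ℚ.+-mono-< 0<B (ℚ.+-mono-< 0<B (ℚ.positive⁻¹ 1ℚ))
      δ , 0<δ , Cδ    = shrink 0<C 0<ε
      N , f = archimedean δ 0<δ
  in K ℕ.⊔ N , λ n n≥ →
     let s≤B = subst (ℚ._≤ B) (ℚ.0≤p⇒∣p∣≡p (0≤√ c n)) (b n (ℕ.m⊔n≤o⇒m≤o K N n≥))
         h≤δ = f n (ℕ.m⊔n≤o⇒n≤o K N n≥)
         s   = √-seq c n
         0≤s+s+h = ℚ.+-mono-≤ (0≤√ c n) (ℚ.+-mono-≤ (0≤√ c n) (ℚ.<⇒≤ (0<h n)))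
         gap : (s ℚ.+ (s ℚ.+ h n)) ℚ.* h n ℚ.≤ ε
         gap = subst ((s ℚ.+ (s ℚ.+ h n)) ℚ.* h n ℚ.≤_) Cδ
           (*-mono-≤₀ 0≤s+s+h (ℚ.<⇒≤ 0<δ)
             (ℚ.+-mono-≤ s≤B (ℚ.+-mono-≤ s≤B (h-antitone {0} {n} z≤n))) h≤δ)
     in abs-intro
       (ℚ.≤-trans (√-lower c n)
         (subst (ℚ._≤ ι c ℚ.+ ε) (ℚ.+-identityʳ (ι c)) (ℚ.+-monoʳ-≤ (ι c) (ℚ.<⇒≤ 0<ε))))
       (ℚ.≤-trans (ℚ.<⇒≤ (√-upper c n))
         (subst (ℚ._≤ s ℚ.* s ℚ.+ ε)
           (solve 2 (λ s h → s :* s :+ (s :+ (s :+ h)) :* h := (s :+ h) :* (s :+ h)) refl s (h n))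
           (ℚ.+-monoʳ-≤ (s ℚ.* s) gap)))
  where open +-*-Solver

instance
  2#0 : 2ℝ # 0ℝ
  2#0 = mk# 1ℚ (ℚ.positive⁻¹ 1ℚ) 0 λ _ _ → /-mono-≤ 1 0 2 0 (s≤s z≤n)

α β : ℝ
α = (1ℝ + √ 5) ÷ 2ℝ
β = (1ℝ - √ 5) ÷ 2ℝ

α-β≈√5 : (α - β) ≈ √ 5
α-β≈√5 = ≗⇒≈ λ n →
  solve 1 (λ s → (con 1ℚ :+ s) :* con ½ :- (con 1ℚ :- s) :* con ½ := s) refl (√-seq 5 n)
  where open +-*-Solver

private
  2≤√5 : ∀ n → + 2 ℚ./ 1 ℚ.≤ √-seq 5 n
  2≤√5 n = /-mono-≤ 2 0 a n (subst (2 ℕ.* d ℕ.≤_) (sym (ℕ.*-identityʳ a)) 2d≤a)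
    where
    d = suc n
    a = isqrt (5 ℕ.* (d ℕ.* d))
    4d²≤5d² : (2 ℕ.* d) ℕ.* (2 ℕ.* d) ℕ.≤ 5 ℕ.* (d ℕ.* d)
    4d²≤5d² = subst (ℕ._≤ 5 ℕ.* (d ℕ.* d)) (sym (ℕ.[m*n]*[o*p]≡[m*o]*[n*p] 2 d 2 d))
      (ℕ.*-monoˡ-≤ (d ℕ.* d) {4} {5} (ℕ.n≤1+n 4))
    2d≤a : 2 ℕ.* d ℕ.≤ a
    2d≤a with 2 ℕ.* d ℕ.≤? a
    ... | yes le = le
    ... | no ≰ = contradiction
      (ℕ.<-≤-trans (isqrt-upper (5 ℕ.* (d ℕ.* d)))
        (ℕ.≤-trans (ℕ.*-mono-≤ (ℕ.≰⇒> ≰) (ℕ.≰⇒> ≰)) 4d²≤5d²))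
      (ℕ.<-irrefl refl)

instance
  α-β#0 : (α - β) # 0ℝ
  α-β#0 = mk# (+ 2 ℚ./ 1) (/-mono-< 0 0 2 0 (s≤s z≤n)) 0 λ n _ →
    subst (+ 2 ℚ./ 1 ℚ.≤_) (sym (trans (cong ∣_∣ (eq (√-seq 5 n))) (ℚ.0≤p⇒∣p∣≡p (0≤√ 5 n)))) (2≤√5 n)
    where
    open +-*-Solver
    eq : ∀ s → ((1ℚ ℚ.+ s) ℚ.* ½ ℚ.- (1ℚ ℚ.- s) ℚ.* ½) ℚ.- 0ℚ ≡ s
    eq = solve 1 (λ s → ((con 1ℚ :+ s) :* con ½ :- (con 1ℚ :- s) :* con ½) :- con 0ℚ := s) refl

Matrix : ℕ → Set
Matrix n = Fin n → Fin n → ℝ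

identity : ∀ {n} → Matrix n
identity i j = if ⌊ i Fin.≟ j ⌋ then 1ℝ else 0ℝ

infixl 7 _⊗_
infixr 8 _^ᴹ_

_⊗_ : ∀ {n} → Matrix n → Matrix n → Matrix n
(M ⊗ N) i j = sum λ l → M i l * N l j

_^ᴹ_ : ∀ {n} → Matrix n → ℕ → Matrix n
M ^ᴹ zero  = identity
M ^ᴹ suc r = M ⊗ M ^ᴹ r

-- Rows and columns are numbered from 1.
index : ∀ {n} → Fin n → ℕ
index i = suc (toℕ i)

Even Odd : ℕ → Set
Even m = 2 ∣ m
Odd  m = ¬ Even m

IsOne : ℕ → ℕ → Set
IsOne i j = (Odd i × j ≡ suc i) ⊎ (Odd j × i ≡ suc j) ⊎ (Even i × i ≡ j)

isOne? : ∀ i j → Dec (IsOne i j)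
isOne? i j =
  (¬? (2 ∣? i) ×-dec (j ℕ.≟ suc i)) ⊎-dec
  (¬? (2 ∣? j) ×-dec (i ℕ.≟ suc j)) ⊎-dec
  ((2 ∣? i) ×-dec (i ℕ.≟ j))

A : ∀ k → Matrix (2 ℕ.* k)
A k i j = if ⌊ isOne? (index i) (index j) ⌋ then 1ℝ else 0ℝ

{-# OPTIONS --safe #-}
-- Row 2m-1 of A has its only 1 in column 2m, and row 2m has its 1s in columns
-- 2m-1 and 2m.  Hence the entries x, y of A ^ r in these two rows of a fixed
-- column evolve by (x , y) ↦ (y , x + y).  The closed forms satisfy the same
-- recurrence because α² = α + 1 and β² = β + 1, and they agree with the identity
-- matrix at r = 0; a column outside the block starts at (0 , 0) and stays there.
module Submission where

open import Defs hiding (sum)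
open import Algebra.Bundles using (CommutativeMonoid; CommutativeRing)
import Algebra.Properties.CommutativeMonoid.Sum as CMSum
open import Data.Bool.Base using (if_then_else_)
open import Data.Fin.Base using (Fin; toℕ; fromℕ<; punchIn; punchOut)
import Data.Fin.Properties as Fin
open import Data.Integer.Base using (+_)
open import Data.Nat.Base using (ℕ; zero; suc; _≤_; _<_) renaming (_*_ to _ℕ*_)
open import Data.Nat.Divisibility
  using (_∣0; ∣-refl; ∣1⇒≡1; ∣m∣n⇒∣m+n; ∣m+n∣m⇒∣n; m∣m*n)
import Data.Nat.Properties as ℕ
open import Data.Product.Base using (_×_; _,_; ∃-syntax; proj₁; proj₂)
open import Data.Rational.Base as ℚ using (ℚ; 0ℚ; 1ℚ; ½)
import Data.Rational.Properties as ℚ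
open import Data.Rational.Solver using (module +-*-Solver)
open import Data.Sum.Base using (_⊎_; inj₁; inj₂)
open import Data.Vec.Functional using (Vector; removeAt)
open import Function.Base using (_∘_)
open import Relation.Binary.PropositionalEquality.Core
  using (_≡_; _≢_; refl; sym; trans; cong; subst)
import Relation.Binary.Reasoning.Setoid as SetoidReasoning
open import Relation.Nullary.Decidable using (Dec; yes; no; ⌊_⌋)
open import Relation.Nullary.Negation using (¬_; contradiction)

open CommutativeRing ℝ-commutativeRing
  using (setoid; reflexive; zeroˡ; +-identityˡ; *-identityˡ; *-comm;
         +-commutativeMonoid)

-- Conditionals on decided propositions

if-yes : ∀ {p a} {P : Set p} {X : Set a} {x y : X} (P? : Dec P) → P →
         (if ⌊ P? ⌋ then x else y) ≡ x
if-yes (yes _) _ = refl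
if-yes (no ¬p) p = contradiction p ¬p

if-no : ∀ {p a} {P : Set p} {X : Set a} {x y : X} (P? : Dec P) → ¬ P →
        (if ⌊ P? ⌋ then x else y) ≡ y
if-no (yes p) ¬p = contradiction p ¬p
if-no (no _)  _  = refl

-- Sums with few nonzero terms

module _ {c ℓ} (M : CommutativeMonoid c ℓ) where
  private
    module M = CommutativeMonoid M
    open CMSum M
    open SetoidReasoning M.setoid

  sum-zero : ∀ {n} (f : Vector M.Carrier n) → (∀ l → f l M.≈ M.ε) → sum f M.≈ M.ε
  sum-zero {n} f f≈0 = M.trans (sum-cong-≋ f≈0) (sum-replicate-zero n)

  sum-single : ∀ {n} (f : Vector M.Carrier n) p → (∀ l → l ≢ p → f l M.≈ M.ε) →
               sum f M.≈ f p
  sum-single {suc n} f p f≈0 = begin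
    sum f                         ≈⟨ sum-remove f ⟩
    f p M.∙ sum (removeAt f p)    ≈⟨ M.∙-congˡ (sum-zero _ λ l → f≈0 _ (Fin.punchInᵢ≢i p l)) ⟩
    f p M.∙ M.ε                   ≈⟨ M.identityʳ _ ⟩
    f p                           ∎

  -- Removing the term at `p` leaves at most one nonzero term, at the position `punchOut p≢q` that
  -- `q` takes once `p` is skipped.
  sum-pair : ∀ {n} (f : Vector M.Carrier n) {p q} → p ≢ q →
             (∀ l → l ≢ p → l ≢ q → f l M.≈ M.ε) → sum f M.≈ f p M.∙ f q
  sum-pair {suc n} f {p} {q} p≢q f≈0 = begin
    sum f                                 ≈⟨ sum-remove f ⟩
    f p M.∙ sum (removeAt f p)            ≈⟨ M.∙-congˡ (sum-single _ (punchOut p≢q) off) ⟩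
    f p M.∙ f (punchIn p (punchOut p≢q))  ≡⟨ cong (λ l → f p M.∙ f l) (Fin.punchIn-punchOut p≢q) ⟩
    f p M.∙ f q                           ∎
    where
    off : ∀ l → l ≢ punchOut p≢q → f (punchIn p l) M.≈ M.ε
    off l l≢ = f≈0 _ (Fin.punchInᵢ≢i p l) λ e → l≢
      (Fin.punchIn-injective p l _ (trans e (sym (Fin.punchIn-punchOut p≢q))))

-- Parity

even⊎even-suc : ∀ m → Even m ⊎ Even (suc m)
even⊎even-suc zero = inj₁ (2 ∣0)
even⊎even-suc (suc m) with even⊎even-suc m
... | inj₁ e = inj₂ (∣m∣n⇒∣m+n ∣-refl e)
... | inj₂ e = inj₁ e

odd⇒even-suc : ∀ {m} → Odd m → Even (suc m)
odd⇒even-suc {m} odd with even⊎even-suc m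
... | inj₁ e = contradiction e odd
... | inj₂ e = e

-- Otherwise 2 would divide two consecutive numbers, hence their difference 1.
even-suc⇒odd : ∀ {m} → Even (suc m) → Odd m
even-suc⇒odd {m} e₁ e₀ with () ← ∣1⇒≡1 (∣m+n∣m⇒∣n (subst Even (ℕ.+-comm 1 m) e₁) e₀)

index-injective : ∀ {n} {i j : Fin n} → index i ≡ index j → i ≡ j
index-injective = Fin.toℕ-injective ∘ ℕ.suc-injective

-- Rows of A

module Block {k} (i i⁻ : Fin (2 ℕ* k)) (even : Even (index i))
             (next : index i ≡ suc (index i⁻)) where

  odd : Odd (index i⁻)
  odd = even-suc⇒odd (subst Even next even)

  i⁻≢i : i⁻ ≢ i
  i⁻≢i refl = odd even

  -- In an odd row only the first case of `IsOne` is possible, and it forces column `i`: the second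
  -- would make the row the successor of an odd number, the third needs an even row.
  A-upper : ∀ l → l ≢ i → ¬ IsOne (index i⁻) (index l)
  A-upper l l≢i (inj₁ (_ , e))               = l≢i (index-injective (trans e (sym next)))
  A-upper l l≢i (inj₂ (inj₁ (oddₗ , e)))     =
    odd (subst Even (sym e) (odd⇒even-suc oddₗ))
  A-upper l l≢i (inj₂ (inj₂ (evenᵢ⁻ , _)))   = odd evenᵢ⁻

  A-lower : ∀ l → l ≢ i⁻ → l ≢ i → ¬ IsOne (index i) (index l)
  A-lower l l≢i⁻ l≢i (inj₁ (oddᵢ , _))       = oddᵢ even
  A-lower l l≢i⁻ l≢i (inj₂ (inj₁ (_ , e)))   =
    l≢i⁻ (index-injective (ℕ.suc-injective (trans (sym e) next)))
  A-lower l l≢i⁻ l≢i (inj₂ (inj₂ (_ , e)))   = l≢i (index-injective (sym e))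

  module _ (N : Matrix (2 ℕ* k)) (j : Fin (2 ℕ* k)) where

    term-one : ∀ p l → IsOne (index p) (index l) → (A k p l * N l j) ≈ N l j
    term-one p l one = ≈-trans
      (*-cong (reflexive (if-yes (isOne? (index p) (index l)) one)) ≈-refl)
      (*-identityˡ (N l j))

    term-zero : ∀ p l → ¬ IsOne (index p) (index l) → (A k p l * N l j) ≈ 0ℝ
    term-zero p l ¬one = ≈-trans
      (*-cong (reflexive (if-no (isOne? (index p) (index l)) ¬one)) ≈-refl)
      (zeroˡ (N l j))

    ⊗-upper : (A k ⊗ N) i⁻ j ≈ N i j
    ⊗-upper = ≈-trans
      (sum-single +-commutativeMonoid _ i λ l l≢i → term-zero i⁻ l (A-upper l l≢i))
      (term-one i⁻ i (inj₁ (odd , next)))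

    ⊗-lower : (A k ⊗ N) i j ≈ N i⁻ j + N i j
    ⊗-lower = ≈-trans
      (sum-pair +-commutativeMonoid _ i⁻≢i λ l l≢i⁻ l≢i → term-zero i l (A-lower l l≢i⁻ l≢i))
      (+-cong (term-one i i⁻ (inj₂ (inj₁ (odd , next))))
              (term-one i i (inj₂ (inj₂ (even , refl)))))

  -- Powers grow by a factor on the left, so the column `j` stays fixed and the two rows of the
  -- block form a closed system. The three kinds of columns differ only in their initial values.
  column : ∀ j (x y : ℕ → ℝ) →
           identity i⁻ j ≈ x 0 → identity i j ≈ y 0 →
           (∀ r → y r ≈ x (suc r)) → (∀ r → (x r + y r) ≈ y (suc r)) →
           ∀ r → ((A k ^ᴹ r) i⁻ j ≈ x r) × ((A k ^ᴹ r) i j ≈ y r)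
  column j x y x₀ y₀ xₛ yₛ zero    = x₀ , y₀
  column j x y x₀ y₀ xₛ yₛ (suc r) =
    let ihx , ihy = column j x y x₀ y₀ xₛ yₛ r
    in ≈-trans (⊗-upper (A k ^ᴹ r) j) (≈-trans ihy (xₛ r))
     , ≈-trans (⊗-lower (A k ^ᴹ r) j) (≈-trans (+-cong ihx ihy) (yₛ r))

identity-diagonal : ∀ {n} (i : Fin n) → identity i i ≈ 1ℝ
identity-diagonal i = reflexive (if-yes (i Fin.≟ i) refl)

identity-off : ∀ {n} {i j : Fin n} → i ≢ j → identity i j ≈ 0ℝ
identity-off {i = i} {j} i≢j = reflexive (if-no (i Fin.≟ j) i≢j)

-- An odd label is paired with its successor, an even one with its predecessor; the work is to show
-- that the partner is in range.
blockOf : ∀ {k} (p : Fin (2 ℕ* k)) →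
          ∃[ i ] ∃[ i⁻ ] Even (index {2 ℕ* k} i) × index i ≡ suc (index {2 ℕ* k} i⁻) ×
            (p ≡ i⁻ ⊎ p ≡ i)
blockOf {k} p with even⊎even-suc (index p)
... | inj₂ e = fromℕ< p⁺<n , p , subst Even (sym eq) e , eq , inj₁ refl
  where
  p⁺<n : index p < 2 ℕ* k
  -- The label of `p` is odd and the size is even, so `p` is not the last index.
  p⁺<n = ℕ.≤∧≢⇒< (Fin.toℕ<n p) λ e′ → even-suc⇒odd e (subst Even (sym e′) (m∣m*n k))
  eq : index (fromℕ< p⁺<n) ≡ suc (index p)
  eq = cong suc (Fin.toℕ-fromℕ< p⁺<n)
... | inj₁ e with toℕ p in toℕp≡ | Fin.toℕ<n p
-- The first index carries the label 1, which is odd.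
...   | zero  | _   with () ← ∣1⇒≡1 e
...   | suc m | m⁺<n = p , fromℕ< m<n , subst (Even ∘ suc) (sym toℕp≡) e
  , cong suc (trans toℕp≡ (cong suc (sym (Fin.toℕ-fromℕ< m<n)))) , inj₂ refl
  where
  m<n : m < 2 ℕ* k
  m<n = ℕ.<-trans (ℕ.n<1+n m) m⁺<n

-- The golden ratio and its conjugate

-- Taking `s` to be √5 or -√5 covers both α and β. The equation s² = 5 holds only in the limit, so
-- it is isolated as one step between two identities that hold term by term: x² = s²/4 + (x - 1/4),
-- and 5/4 - 1/4 = 1.
half-square : ∀ s → (s * s) ≈ fromℚ (+ 5 ℚ./ 1) →
              let x = (1ℝ + s) ÷ 2ℝ in (x * x) ≈ (x + 1ℝ)
half-square s s²≈5 = begin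
  x * x                                            ≈⟨ ≗⇒≈ (λ n → expand (seq s n)) ⟩
  fromℚ ¼ * (s * s) + (x - fromℚ ¼)                ≈⟨ +-cong (*-cong ≈-refl s²≈5) ≈-refl ⟩
  fromℚ ¼ * fromℚ (+ 5 ℚ./ 1) + (x - fromℚ ¼)      ≈⟨ ≗⇒≈ (λ n → collect (seq s n)) ⟩
  x + 1ℝ                                           ∎
  where
  open SetoidReasoning setoid
  open +-*-Solver
  x = (1ℝ + s) ÷ 2ℝ
  ¼ = + 1 ℚ./ 4
  -- Every term of the inverse of `2ℝ` evaluates to ½, so `y` gives the terms of `x`.
  y : ℚ → ℚ
  y t = (1ℚ ℚ.+ t) ℚ.* ½
  expand : ∀ t → y t ℚ.* y t ≡ ¼ ℚ.* (t ℚ.* t) ℚ.+ (y t ℚ.- ¼)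
  expand = solve 1 (λ t → let y = (con 1ℚ :+ t) :* con ½ in
    y :* y := con ¼ :* (t :* t) :+ (y :- con ¼)) refl
  collect : ∀ t → ¼ ℚ.* (+ 5 ℚ./ 1) ℚ.+ (y t ℚ.- ¼) ≡ y t ℚ.+ 1ℚ
  collect = solve 1 (λ t → let y = (con 1ℚ :+ t) :* con ½ in
    con ¼ :* con (+ 5 ℚ./ 1) :+ (y :- con ¼) := y :+ con 1ℚ) refl

α²≈α+1 : (α * α) ≈ (α + 1ℝ)
α²≈α+1 = half-square (√ 5) (√-square 5)

β²≈β+1 : (β * β) ≈ (β + 1ℝ)
β²≈β+1 = half-square (- √ 5) (≈-trans
  (≗⇒≈ λ n → solve 1 (λ s → (:- s) :* (:- s) := s :* s) refl (seq (√ 5) n)) (√-square 5))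
  where open +-*-Solver

^-fibonacci : ∀ x → (x * x) ≈ (x + 1ℝ) → ∀ r → x ^ suc (suc r) ≈ (x ^ r + x ^ suc r)
^-fibonacci x x²≈x+1 r = begin
  x * (x * x ^ r)      ≈⟨ ≗⇒≈ (λ n → ℚ.*-assoc (seq x n) (seq x n) (seq (x ^ r) n)) ⟨
  x * x * x ^ r        ≈⟨ *-cong x²≈x+1 ≈-refl ⟩
  (x + 1ℝ) * x ^ r     ≈⟨ ≗⇒≈ (λ n → solve 2 (λ x p → (x :+ con 1ℚ) :* p := p :+ x :* p)
                                        refl (seq x n) (seq (x ^ r) n)) ⟩
  x ^ r + x * x ^ r    ∎
  where
  open SetoidReasoning setoid
  open +-*-Solver

-- Binet formulas

κ : ℝ
κ = _÷_ 1ℝ (α - β) {{α-β#0}}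

κ-inverse : (κ * (α - β)) ≈ 1ℝ
κ-inverse = begin
  κ * (α - β)                  ≈⟨ *-cong (*-identityˡ (inv (α - β) α-β#0)) ≈-refl ⟩
  inv (α - β) α-β#0 * (α - β)  ≈⟨ *-comm (inv (α - β) α-β#0) (α - β) ⟩
  (α - β) * inv (α - β) α-β#0  ≈⟨ *-inverseʳ (α - β) α-β#0 ⟩
  1ℝ                           ∎
  where open SetoidReasoning setoid

-- Both columns of a block are instances, so one recurrence serves both: weights (1, -1) give the
-- Fibonacci number F(r), and weights (-β, α) give F(r-1), because αβ = -1.
binet : ℝ → ℝ → ℕ → ℝ
binet s t r = κ * (s * α ^ r + t * β ^ r)

binet-step : ∀ s t r → (binet s t r + binet s t (suc r)) ≈ binet s t (suc (suc r))
binet-step s t r = begin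
  binet s t r + binet s t (suc r)
    ≈⟨ ≗⇒≈ (λ n → regroup (seq κ n) (seq s n) (seq t n) (seq (α ^ r) n) (seq (α ^ suc r) n)
                          (seq (β ^ r) n) (seq (β ^ suc r) n)) ⟩
  κ * (s * (α ^ r + α ^ suc r) + t * (β ^ r + β ^ suc r))
    ≈⟨ *-cong (≈-refl {κ}) (+-cong (*-cong (≈-refl {s}) (^-fibonacci α α²≈α+1 r))
                                   (*-cong (≈-refl {t}) (^-fibonacci β β²≈β+1 r))) ⟨
  binet s t (suc (suc r)) ∎
  where
  open SetoidReasoning setoid
  open +-*-Solver
  regroup : ∀ c s t a a′ b b′ →
    c ℚ.* (s ℚ.* a ℚ.+ t ℚ.* b) ℚ.+ c ℚ.* (s ℚ.* a′ ℚ.+ t ℚ.* b′) ≡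
    c ℚ.* (s ℚ.* (a ℚ.+ a′) ℚ.+ t ℚ.* (b ℚ.+ b′))
  regroup = solve 7 (λ c s t a a′ b b′ →
    c :* (s :* a :+ t :* b) :+ c :* (s :* a′ :+ t :* b′) :=
    c :* (s :* (a :+ a′) :+ t :* (b :+ b′))) refl

-- Kept in the shape used by the theorem, so that its entries match by unfolding; `fib≈binet`
-- carries the recurrence over.
fib : ℕ → ℝ
fib r = κ * (α ^ r - β ^ r)

fib≈binet : ∀ r → fib r ≈ binet 1ℝ (- 1ℝ) r
fib≈binet r = ≗⇒≈ λ n → solve 3 (λ c a b → c :* (a :- b) :=
    c :* (con 1ℚ :* a :+ (:- con 1ℚ) :* b)) refl (seq κ n) (seq (α ^ r) n) (seq (β ^ r) n)
  where open +-*-Solver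

fib-step : ∀ r → (fib r + fib (suc r)) ≈ fib (suc (suc r))
fib-step r = ≈-trans (+-cong (fib≈binet r) (fib≈binet (suc r)))
  (≈-trans (binet-step 1ℝ (- 1ℝ) r) (≈-sym (fib≈binet (suc (suc r)))))

fib-zero : fib 0 ≈ 0ℝ
fib-zero = ≗⇒≈ λ n → ℚ.*-zeroʳ (seq κ n)

fib-one : fib 1 ≈ 1ℝ
fib-one = ≈-trans (≗⇒≈ λ n → solve 3 (λ c a b →
    c :* (a :* con 1ℚ :- b :* con 1ℚ) := c :* (a :- b)) refl (seq κ n) (seq α n) (seq β n))
  κ-inverse
  where open +-*-Solver

binet-zero : binet (- β) α 0 ≈ 1ℝ
binet-zero = ≈-trans (≗⇒≈ λ n → solve 3 (λ c a b →
    c :* ((:- b) :* con 1ℚ :+ a :* con 1ℚ) := c :* (a :- b)) refl (seq κ n) (seq α n) (seq β n))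
  κ-inverse
  where open +-*-Solver

-- The products -βα and αβ cancel already term by term.
binet-one : binet (- β) α 1 ≈ 0ℝ
binet-one = ≗⇒≈ λ n → solve 3 (λ c a b →
    c :* ((:- b) :* (a :* con 1ℚ) :+ a :* (b :* con 1ℚ)) := con 0ℚ)
    refl (seq κ n) (seq α n) (seq β n)
  where open +-*-Solver

-- Columns of the powers of `A`

module _ {k} (i i⁻ : Fin (2 ℕ* k)) (even : Even (index i))
         (next : index i ≡ suc (index i⁻)) where
  open Block {k} i i⁻ even next

  -- The lower entry is the upper entry one step later, so a single sequence and its shift describe
  -- the column. It starts with 1, 0, the entries of the identity matrix.
  column-i⁻ : ∀ r → ((A k ^ᴹ r) i⁻ i⁻ ≈ binet (- β) α r)
                  × ((A k ^ᴹ r) i i⁻ ≈ binet (- β) α (suc r))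
  column-i⁻ = column i⁻ (binet (- β) α) (binet (- β) α ∘ suc)
    (≈-trans (identity-diagonal i⁻) (≈-sym binet-zero))
    (≈-trans (identity-off (i⁻≢i ∘ sym)) (≈-sym binet-one))
    (λ _ → ≈-refl) (binet-step (- β) α)

  column-i : ∀ r → ((A k ^ᴹ r) i⁻ i ≈ fib r) × ((A k ^ᴹ r) i i ≈ fib (suc r))
  column-i = column i fib (fib ∘ suc)
    (≈-trans (identity-off i⁻≢i) (≈-sym fib-zero))
    (≈-trans (identity-diagonal i) (≈-sym fib-one))
    (λ _ → ≈-refl) fib-step

  column-outside : ∀ {j} → i⁻ ≢ j → i ≢ j → ∀ r →
                   ((A k ^ᴹ r) i⁻ j ≈ 0ℝ) × ((A k ^ᴹ r) i j ≈ 0ℝ)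
  column-outside {j} i⁻≢j i≢j = column j (λ _ → 0ℝ) (λ _ → 0ℝ)
    (identity-off i⁻≢j) (identity-off i≢j) (λ _ → ≈-refl) (λ _ → +-identityˡ 0ℝ)

-- The instance of _÷_ is given by name because instance search would put its
-- η-expansion, a very large term, into the type.
mainTheorem1 : (k : ℕ) → 1 ≤ k → (r : ℕ) → 1 ≤ r →
    let n = 2 ℕ* k
        a = A k ^ᴹ r
    in ((i i-1 : Fin n) → Even (index i) → index i ≡ suc (index i-1) →
          (a i-1 i-1 ≈ (_÷_ 1ℝ (α - β) {{α-β#0}}) * ((- β) * α ^ r + α * β ^ r))
        × (a i i ≈ (_÷_ 1ℝ (α - β) {{α-β#0}}) * (α ^ suc r - β ^ suc r))
        × (a i-1 i ≈ (_÷_ 1ℝ (α - β) {{α-β#0}}) * (α ^ r - β ^ r))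
        × (a i i-1 ≈ (_÷_ 1ℝ (α - β) {{α-β#0}}) * ((- β) * α ^ suc r + α * β ^ suc r)))
       × ((p q : Fin n) →
          ¬ (∃[ i ] ∃[ i-1 ] Even (index {n} i) × index i ≡ suc (index {n} i-1)
             × (p ≡ i-1 ⊎ p ≡ i) × (q ≡ i-1 ⊎ q ≡ i)) →
          a p q ≈ 0ℝ)
mainTheorem1 k _ r _ =
    -- The second index of each entry selects the column lemma, the first index its component.
    (λ i i⁻ even next → proj₁ (column-i⁻ {k} i i⁻ even next r)
                      , proj₂ (column-i {k} i i⁻ even next r)
                      , proj₁ (column-i {k} i i⁻ even next r)
                      , proj₂ (column-i⁻ {k} i i⁻ even next r))
  , outside
  where
  outside : ∀ p q →
    ¬ (∃[ i ] ∃[ i⁻ ] Even (index {2 ℕ* k} i) × index i ≡ suc (index {2 ℕ* k} i⁻)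
       × (p ≡ i⁻ ⊎ p ≡ i) × (q ≡ i⁻ ⊎ q ≡ i)) →
    (A k ^ᴹ r) p q ≈ 0ℝ
  outside p q ¬block with blockOf {k} p
  ... | i , i⁻ , even , next , p∈ = pick p∈
    where
    zeros : ((A k ^ᴹ r) i⁻ q ≈ 0ℝ) × ((A k ^ᴹ r) i q ≈ 0ℝ)
    zeros = column-outside {k} i i⁻ even next
      -- If `q` were one of the two indices of the block of `p`, that block would contain both,
      -- against `¬block`.
      (λ e → ¬block (i , i⁻ , even , next , p∈ , inj₁ (sym e)))
      (λ e → ¬block (i , i⁻ , even , next , p∈ , inj₂ (sym e))) r
    pick : p ≡ i⁻ ⊎ p ≡ i → (A k ^ᴹ r) p q ≈ 0ℝ
    pick (inj₁ refl) = proj₁ zeros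
    pick (inj₂ refl) = proj₂ zeros
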